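{- Let $q \ge 4$ be a prime power and let $1\le d\le e$ be integers. Then $|B_j(1)| \geq |B_j(i)|$ for all integers $i,j$ with $1 \le i \le d$ and $0 \le j \le d$.
   Context: With Gaussian coefficients $\genfrac{[}{]}{0pt}{}{a}{m} = \prod_{h=0}^{m-1}\frac{q^{a-h}-1}{q^{m-h}-1}$ (and $0$ if $m<0$), for $0\le i,j\le d$, $$B_j(i) = \sum_{h=0}^j (-1)^{j-h} \, q^{eh+\binom{j-h}{2}} \genfrac{[}{]}{0pt}{}{d-h}{d-j} \genfrac{[}{]}{0pt}{}{d-i}{h}.$$ The numbers $B_j(i)$, $0\le i\le d$, are the eigenvalues of the distance-$j$ graph of the bilinear forms graph $H_q(d,e)$, whose vertices are the $d\times e$ matrices over $\mathbb{F}_q$, adjacent when their difference has rank 1. -}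

module Defs where

open import Data.Fin.Base using (Fin; toℕ)
open import Data.Fin.Properties using (toℕ<n)
open import Data.Integer.Base as ℤ using (ℤ; +_; -1ℤ; 1ℤ)
open import Data.Nat.Base
open import Data.Nat.Combinatorics using (_C_)
open import Data.Nat.Primality using (Prime)
open import Data.Nat.Properties using (^-monoʳ-<; m<n⇒0<n∸m)
open import Data.Product.Base using (∃₂; _×_)
open import Data.Rational.Base as ℚ using (ℚ)
open import Data.Rational.Properties using (+-0-commutativeMonoid; *-1-commutativeMonoid)
open import Relation.Binary.PropositionalEquality.Core using (_≡_)
import Algebra.Properties.CommutativeMonoid.Sum as BigOp

open BigOp +-0-commutativeMonoid public using () renaming (sum to Σℚ)
open BigOp *-1-commutativeMonoid public using () renaming (sum to Πℚ)

PrimePower : ℕ → Set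
PrimePower q = ∃₂ λ p k → Prime p × 1 ≤ k × q ≡ p ^ k

q^[m∸h]∸1≢0 : ∀ q .{{_ : NonTrivial q}} m (h : Fin m) → NonZero (q ^ (m ∸ toℕ h) ∸ 1)
q^[m∸h]∸1≢0 q m h =
  >-nonZero (m<n⇒0<n∸m (^-monoʳ-< q (nonTrivial⇒n>1 q) (m<n⇒0<n∸m (toℕ<n h))))

-- When h > a the exponent a ∸ h is truncated to 0, but the product already
-- vanishes there because of its factor at h = a.
-- The convention for m < 0 is not needed: every lower index used below is a
-- natural number.
gaussian : (q : ℕ) → .{{NonTrivial q}} → ℕ → ℕ → ℚ
gaussian q a m = Πℚ {m} λ h →
  ((+ (q ^ (a ∸ toℕ h)) ℤ.- 1ℤ) ℚ./ (q ^ (m ∸ toℕ h) ∸ 1)) {{q^[m∸h]∸1≢0 q m h}}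

-- B q d e j i is B_j(i) for the d × e bilinear forms graph over the field of
-- order q.  It is meaningful for i , j ≤ d, where no subtraction d ∸ h, d ∸ j,
-- d ∸ i or j ∸ h is truncated.
B : (q : ℕ) → .{{NonTrivial q}} → (d e j i : ℕ) → ℚ
B q d e j i = Σℚ {suc j} λ k → term (toℕ k)
  where
  term : ℕ → ℚ
  term h = (-1ℤ ℤ.^ (j ∸ h) ℤ.* + (q ^ (e * h + (j ∸ h) C 2))) ℚ./ 1
           ℚ.* gaussian q (d ∸ h) (d ∸ j)
           ℚ.* gaussian q (d ∸ i) h

4≤⇒nonTrivial : ∀ {q} → 4 ≤ q → NonTrivial q
4≤⇒nonTrivial (s≤s (s≤s _)) = nonTrivial

{-# OPTIONS --safe #-}

-- Only the summands with h ≤ k := min(j, d − i) are nonzero.  Up to k the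
-- absolute value T i h of the h-th summand at least doubles with each step of h
-- (its ratio is about q^(e−i−h), and e − i − h ≥ 1), so the alternating sum lies
-- between T i k / 2 and T i k in absolute value.  The dominant term T i k in turn
-- at least halves with each step of i when j ≥ 1.  Hence, for i ≥ 2, the dominant
-- term of B_j(1) is at least 2 |B_j(i)| and at most 2 |B_j(1)|.
module Submission where

open import Defs
open import Data.Nat.Base using (ℕ; _≤_)
open import Data.Rational.Base using (∣_∣; _≥_)
open import Data.Fin.Base as Fin using (toℕ)
open import Data.Integer.Base as ℤ using (ℤ; +_; 0ℤ; 1ℤ; -1ℤ; +≤+)
open import Data.Integer.Tactic.RingSolver as ℤ-Ring using ()
import Data.Integer.Properties as ℤₚ
open import Data.Nat.Base
  using (zero; suc; _+_; _*_; _∸_; _^_; _⊓_; _<_; z≤n; s≤s; NonZero; NonTrivial; >-nonZero)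
open import Data.Nat.Combinatorics using (_C_; nC1≡n; nCk+nC[k+1]≡[n+1]C[k+1])
open import Data.Nat.Properties
open import Data.Nat.Tactic.RingSolver using (solve-∀)
open import Data.Product.Base using (∃; _×_; _,_)
open import Data.Rational.Base as ℚ using (ℚ; 0ℚ; *≤*)
open import Data.Rational.Literals using (fromℤ)
import Data.Rational.Properties as ℚₚ
import Data.Rational.Unnormalised.Base as ℚᵘ
import Data.Rational.Unnormalised.Properties as ℚᵘₚ
open import Data.Sum.Base using (inj₁; inj₂)
open import Function.Base using (_∘_)
open import Relation.Nullary.Negation using (contradiction)
open import Relation.Binary.PropositionalEquality
  using (_≡_; refl; sym; trans; cong; cong₂; subst; subst₂; module ≡-Reasoning)

-- Predecessors and triangular numbers in ℕ

∸-suc-≡ : ∀ {m n} → n < m → m ∸ n ≡ suc (m ∸ suc n)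
∸-suc-≡ {suc m} {n} (s≤s n≤m) = +-∸-assoc 1 n≤m

[1+n]C2≡n+nC2 : ∀ n → suc n C 2 ≡ n + n C 2
[1+n]C2≡n+nC2 n = trans (sym (nCk+nC[k+1]≡[n+1]C[k+1] n 1)) (cong (_+ n C 2) (nC1≡n n))

-- Alternating sums

-- The sign of the h-th term is (-1)^(k-h), as in B_j(i), so the last term always counts positively.
altSum : (ℕ → ℕ) → ℕ → ℤ
altSum f zero    = + f 0
altSum f (suc k) = + f (suc k) ℤ.- altSum f k

-- Peels off the bottom term: `Σℚ` unfolds from index 0, while `altSum` recurses from the top.
altSum-suc : ∀ f k → altSum f (suc k) ≡ -1ℤ ℤ.^ suc k ℤ.* + f 0 ℤ.+ altSum (f ∘ suc) k
altSum-suc f zero = lemma (+ f 1) (+ f 0)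
  where
  lemma : ∀ x y → x ℤ.- y ≡ -1ℤ ℤ.^ 1 ℤ.* y ℤ.+ x
  lemma = ℤ-Ring.solve-∀
altSum-suc f (suc k) = trans (cong (λ z → + f (2 + k) ℤ.- z) (altSum-suc f k))
  (lemma (+ f (2 + k)) (-1ℤ ℤ.^ suc k) (+ f 0) (altSum (f ∘ suc) k))
  where
  lemma : ∀ x s y z → x ℤ.- (s ℤ.* y ℤ.+ z) ≡ (-1ℤ ℤ.* s) ℤ.* y ℤ.+ (x ℤ.- z)
  lemma = ℤ-Ring.solve-∀

-- The previous sum a satisfies 0 ≤ a ≤ f k, hence 2a ≤ f (k + 1), and subtracting a from f (k + 1)
-- removes at most half of it. Only the upper bound is carried through the induction; the witness in
-- ℕ records that the sum is nonnegative.
altSum-bounds : ∀ f k → (∀ h → h < k → 2 * f h ≤ f (suc h)) →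
                ∃ λ a → altSum f k ≡ + a × a ≤ f k × f k ≤ 2 * a
altSum-bounds f zero    dbl = f 0 , refl , ≤-refl , m≤n*m (f 0) 2
altSum-bounds f (suc k) dbl =
  let a , eq , a≤fk , _ = altSum-bounds f k (λ h h<k → dbl h (m≤n⇒m≤1+n h<k))
      2a≤x : 2 * a ≤ f (suc k)
      2a≤x = ≤-trans (*-monoʳ-≤ 2 a≤fk) (dbl k ≤-refl)
      a≤x : a ≤ f (suc k)
      a≤x = ≤-trans (m≤n*m a 2) 2a≤x
  in f (suc k) ∸ a
   , trans (cong (λ z → + f (suc k) ℤ.- z) eq) (trans (ℤₚ.m-n≡m⊖n _ a) (ℤₚ.⊖-≥ a≤x))
   , m∸n≤m _ a
   , half a≤x 2a≤x
  where
  open ≤-Reasoning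
  half : ∀ {a x} → a ≤ x → 2 * a ≤ x → x ≤ 2 * (x ∸ a)
  half {a} {x} a≤x 2a≤x = begin
    x                ≡⟨ m+n∸n≡m x x ⟨
    x + x ∸ x        ≤⟨ ∸-monoʳ-≤ (x + x) 2a≤x ⟩
    x + x ∸ 2 * a    ≡⟨ cong (λ y → x + y ∸ 2 * a) (sym (+-identityʳ x)) ⟩
    2 * x ∸ 2 * a    ≡⟨ *-distribˡ-∸ 2 x a ⟨
    2 * (x ∸ a)      ∎

-- Signs are counted from the top, so each trailing zero flips the sign of the sum; only its
-- absolute value is preserved.
∣altSum∣-vanishing : ∀ f k r → (∀ h → k < h → h ≤ r + k → f h ≡ 0) →
                     ℤ.∣ altSum f (r + k) ∣ ≡ ℤ.∣ altSum f k ∣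
∣altSum∣-vanishing f k zero    f≡0 = refl
∣altSum∣-vanishing f k (suc r) f≡0 rewrite f≡0 (suc r + k) (s≤s (m≤n+m k r)) ≤-refl =
  trans (cong ℤ.∣_∣ (ℤₚ.+-identityˡ (ℤ.- altSum f (r + k))))
    (trans (ℤₚ.∣-i∣≡∣i∣ (altSum f (r + k)))
      (∣altSum∣-vanishing f k r (λ h k<h h≤r+k → f≡0 h k<h (m≤n⇒m≤1+n h≤r+k))))

-- Integers inside ℚ

i/1≡fromℤ : ∀ i → i ℚ./ 1 ≡ fromℤ i
i/1≡fromℤ i = ℚₚ.↥p/↧p≡p (fromℤ i)

fromℤ-* : ∀ i j → fromℤ i ℚ.* fromℤ j ≡ fromℤ (i ℤ.* j)
fromℤ-* i j = i/1≡fromℤ (i ℤ.* j)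

fromℤ-+ : ∀ i j → fromℤ i ℚ.+ fromℤ j ≡ fromℤ (i ℤ.+ j)
fromℤ-+ i j = trans (i/1≡fromℤ _)
  (cong₂ (λ x y → fromℤ (x ℤ.+ y)) (ℤₚ.*-identityʳ i) (ℤₚ.*-identityʳ j))

∣fromℤ∣ : ∀ i → ∣ fromℤ i ∣ ≡ fromℤ (+ ℤ.∣ i ∣)
∣fromℤ∣ (+ n)      = refl
∣fromℤ∣ ℤ.-[1+ n ] = refl

fromℤ-mono-≤ : ∀ {i j} → i ℤ.≤ j → fromℤ i ℚ.≤ fromℤ j
fromℤ-mono-≤ {i} {j} i≤j =
  *≤* (subst₂ ℤ._≤_ (sym (ℤₚ.*-identityʳ i)) (sym (ℤₚ.*-identityʳ j)) i≤j)

-- Passing to unnormalised rationals reduces the equation to cross-multiplication, free of gcds.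
/-*-fromℤ : ∀ i n .{{_ : NonZero n}} j k → i ℤ.* j ≡ k ℤ.* + n → i ℚ./ n ℚ.* fromℤ j ≡ fromℤ k
/-*-fromℤ i n@(suc _) j k eq = ℚₚ.toℚᵘ-injective (begin
  ℚ.toℚᵘ (i ℚ./ n ℚ.* fromℤ j)               ≈⟨ ℚₚ.toℚᵘ-homo-* (i ℚ./ n) (fromℤ j) ⟩
  ℚ.toℚᵘ (i ℚ./ n) ℚᵘ.* ℚ.toℚᵘ (fromℤ j)     ≈⟨ ℚᵘₚ.*-congʳ (ℚₚ.toℚᵘ-fromℚᵘ (i ℚᵘ./ n)) ⟩
  (i ℚᵘ./ n) ℚᵘ.* ℚ.toℚᵘ (fromℤ j)           ≈⟨ ℚᵘ.*≡* cross ⟩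
  ℚ.toℚᵘ (fromℤ k)                           ∎)
  where
  open ℚᵘₚ.≃-Reasoning
  cross : i ℤ.* j ℤ.* 1ℤ ≡ k ℤ.* + (n * 1)
  cross = trans (ℤₚ.*-identityʳ (i ℤ.* j)) (trans eq (cong (λ m → k ℤ.* + m) (sym (*-identityʳ n))))

Σℚ-cong : ∀ {n} {f g : ℕ → ℚ} → (∀ h → f h ≡ g h) →
          Σℚ {n} (λ k → f (toℕ k)) ≡ Σℚ {n} (λ k → g (toℕ k))
Σℚ-cong {zero}  eq = refl
Σℚ-cong {suc n} eq = cong₂ ℚ._+_ (eq 0) (Σℚ-cong {n} (λ h → eq (suc h)))

Σℚ-altSum : ∀ f j →
  Σℚ {suc j} (λ k → fromℤ (-1ℤ ℤ.^ (j ∸ toℕ k) ℤ.* + f (toℕ k))) ≡ fromℤ (altSum f j)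
Σℚ-altSum f zero = trans (ℚₚ.+-identityʳ _) (cong fromℤ (ℤₚ.*-identityˡ (+ f 0)))
Σℚ-altSum f (suc j) = trans
  (cong (fromℤ (-1ℤ ℤ.^ suc j ℤ.* + f 0) ℚ.+_) (Σℚ-altSum (f ∘ suc) j))
  (trans (fromℤ-+ (-1ℤ ℤ.^ suc j ℤ.* + f 0) (altSum (f ∘ suc) j))
    (cong fromℤ (sym (altSum-suc f j))))

module _ (p : ℕ) where

  private
    q : ℕ
    q = suc p

  -- Gaussian coefficients over ℕ

  -- The q-number 1 + q + ... + q^(n-1). Since q is `suc p`, the factor q - 1 is `p` and (q - 1)[n]
  -- = q^n - 1 can be stated without subtraction.
  [_] : ℕ → ℕ
  [ zero  ] = 0
  [ suc n ] = 1 + q * [ n ]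

  p*[n]+1≡q^n : ∀ n → suc (p * [ n ]) ≡ q ^ n
  p*[n]+1≡q^n zero    = cong suc (*-zeroʳ p)
  p*[n]+1≡q^n (suc n) = trans (lemma p [ n ]) (cong (q *_) (p*[n]+1≡q^n n))
    where
    lemma : ∀ p x → suc (p * (1 + suc p * x)) ≡ suc p * suc (p * x)
    lemma = solve-∀

  [m+n]≡[m]+q^m*[n] : ∀ m n → [ m + n ] ≡ [ m ] + q ^ m * [ n ]
  [m+n]≡[m]+q^m*[n] zero    n = sym (+-identityʳ [ n ])
  [m+n]≡[m]+q^m*[n] (suc m) n =
    trans (cong (λ x → 1 + q * x) ([m+n]≡[m]+q^m*[n] m n)) (lemma q [ m ] (q ^ m) [ n ])
    where
    lemma : ∀ q x y z → 1 + q * (x + y * z) ≡ 1 + q * x + q * y * z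
    lemma = solve-∀

  q^n≤[1+n] : ∀ n → q ^ n ≤ [ suc n ]
  q^n≤[1+n] zero    = s≤s z≤n
  q^n≤[1+n] (suc n) = ≤-trans (*-monoʳ-≤ q (q^n≤[1+n] n)) (n≤1+n _)

  p*[n]≤q^n : ∀ n → p * [ n ] ≤ q ^ n
  p*[n]≤q^n n = subst (p * [ n ] ≤_) (p*[n]+1≡q^n n) (n≤1+n _)

  -- Defined by the q-Pascal rule, which makes integrality and positivity automatic;
  -- `gaussian≡gauss` identifies it with the product formula.
  gauss : ℕ → ℕ → ℕ
  gauss n       zero    = 1
  gauss zero    (suc m) = 0
  gauss (suc n) (suc m) = gauss n m + q ^ suc m * gauss n (suc m)

  gauss-vanishes : ∀ {n m} → n < m → gauss n m ≡ 0
  gauss-vanishes {zero}  {suc m} _         = refl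
  gauss-vanishes {suc n} {suc m} (s≤s n<m) = trans
    (cong₂ (λ x y → x + q ^ suc m * y) (gauss-vanishes n<m) (gauss-vanishes (m≤n⇒m≤1+n n<m)))
    (*-zeroʳ (q ^ suc m))

  gauss-diag : ∀ n → gauss n n ≡ 1
  gauss-diag zero    = refl
  gauss-diag (suc n) =
    trans (cong₂ (λ x y → x + q ^ suc n * y) (gauss-diag n) (gauss-vanishes (n<1+n n)))
      (cong suc (*-zeroʳ (q ^ suc n)))

  -- The factor `gauss n l` absorbs truncation: for m ≤ n this is the splitting of [n + 1] at m + 1,
  -- and for n < m ≤ l both sides are 0.
  gauss-split : ∀ n m l → m ≤ l →
                gauss n l * ([ suc m ] + q ^ suc m * [ n ∸ m ]) ≡ gauss n l * [ suc n ]
  gauss-split n m l m≤l with ≤-<-connex m n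
  ... | inj₁ m≤n = cong (gauss n l *_)
    (trans (sym ([m+n]≡[m]+q^m*[n] (suc m) (n ∸ m))) (cong (λ x → [ suc x ]) (m+[n∸m]≡n m≤n)))
  ... | inj₂ n<m rewrite gauss-vanishes (<-≤-trans n<m m≤l) = refl

  -- The ratios of neighbouring Gaussian coefficients, with denominators cleared. The three are
  -- proved by one mutual induction on n: the last two at n follow from the q-Pascal rule and
  -- `gauss-lower n`, and together they give `gauss-lower (suc n)`.
  gauss-lower : ∀ n m → gauss n (suc m) * [ suc m ] ≡ gauss n m * [ n ∸ m ]
  gauss-upper-lower : ∀ n m → gauss (suc n) (suc m) * [ suc m ] ≡ gauss n m * [ suc n ]
  gauss-upper : ∀ n m → gauss (suc n) m * [ suc n ∸ m ] ≡ gauss n m * [ suc n ]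

  gauss-lower zero    zero    = refl
  gauss-lower zero    (suc m) = refl
  gauss-lower (suc n) m       = trans (gauss-upper-lower n m) (sym (gauss-upper n m))

  gauss-upper-lower n m = begin
    (x + c * y) * [ suc m ]           ≡⟨ lemma₁ x c y [ suc m ] ⟩
    x * [ suc m ] + c * (y * [ suc m ]) ≡⟨ cong (λ z → x * [ suc m ] + c * z) (gauss-lower n m) ⟩
    x * [ suc m ] + c * (x * [ n ∸ m ]) ≡⟨ lemma₂ x c [ suc m ] [ n ∸ m ] ⟩
    x * ([ suc m ] + c * [ n ∸ m ])     ≡⟨ gauss-split n m m ≤-refl ⟩
    x * [ suc n ]                       ∎
    where
    open ≡-Reasoning
    x = gauss n m
    y = gauss n (suc m)
    c = q ^ suc m
    lemma₁ : ∀ x c y s → (x + c * y) * s ≡ x * s + c * (y * s)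
    lemma₁ = solve-∀
    lemma₂ : ∀ x c s t → x * s + c * (x * t) ≡ x * (s + c * t)
    lemma₂ = solve-∀

  gauss-upper n zero    = refl
  gauss-upper n (suc m) = begin
    (x + c * y) * [ n ∸ m ]             ≡⟨ lemma₁ x c y [ n ∸ m ] ⟩
    x * [ n ∸ m ] + c * (y * [ n ∸ m ]) ≡⟨ cong (_+ c * (y * [ n ∸ m ])) (gauss-lower n m) ⟨
    y * [ suc m ] + c * (y * [ n ∸ m ]) ≡⟨ lemma₂ y c [ suc m ] [ n ∸ m ] ⟩
    y * ([ suc m ] + c * [ n ∸ m ])     ≡⟨ gauss-split n m (suc m) (n≤1+n m) ⟩
    y * [ suc n ]                       ∎
    where
    open ≡-Reasoning
    x = gauss n m
    y = gauss n (suc m)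
    c = q ^ suc m
    lemma₁ : ∀ x c y s → (x + c * y) * s ≡ x * s + c * (y * s)
    lemma₁ = solve-∀
    lemma₂ : ∀ x c s t → x * s + c * (x * t) ≡ x * (s + c * t)
    lemma₂ = solve-∀

  q^n-1≡p*[n] : ∀ n → + (q ^ n) ℤ.- 1ℤ ≡ + (p * [ n ])
  q^n-1≡p*[n] n = cong (λ x → + x ℤ.- 1ℤ) (sym (p*[n]+1≡q^n n))

  -- Without its first factor, the product for (a + 1, m + 1) is the product for (a, m), so
  -- `gauss-upper-lower` gives the step. For a = 0 and m > 0 the first factor is 0.
  gaussian≡gauss : .{{_ : NonTrivial q}} → ∀ a m → gaussian q a m ≡ fromℤ (+ gauss a m)
  gaussian≡gauss a       zero    = refl
  gaussian≡gauss zero    (suc m) = trans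
    (cong (ℚ._* tail) (ℚₚ.0/n≡0 (q ^ suc m ∸ 1) {{nz}})) (ℚₚ.*-zeroˡ tail)
    where
    tail = Πℚ {m} λ h → (0ℤ ℚ./ (q ^ (m ∸ toℕ h) ∸ 1)) {{q^[m∸h]∸1≢0 q m h}}
    nz = q^[m∸h]∸1≢0 q (suc m) Fin.zero
  gaussian≡gauss (suc a) (suc m) = trans
    (cong (((+ (q ^ suc a) ℤ.- 1ℤ) ℚ./ (q ^ suc m ∸ 1)) {{nz}} ℚ.*_) (gaussian≡gauss a m))
    (/-*-fromℤ (+ (q ^ suc a) ℤ.- 1ℤ) (q ^ suc m ∸ 1) {{nz}} (+ gauss a m) (+ gauss (suc a) (suc m)) cross)
    where
    nz = q^[m∸h]∸1≢0 q (suc m) Fin.zero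
    open ≡-Reasoning
    lemma : ∀ p x g → p * x * g ≡ p * (g * x)
    lemma = solve-∀
    lemma′ : ∀ p x g → p * (g * x) ≡ g * (p * x)
    lemma′ = solve-∀
    cross : (+ (q ^ suc a) ℤ.- 1ℤ) ℤ.* + gauss a m ≡ + gauss (suc a) (suc m) ℤ.* + (q ^ suc m ∸ 1)
    cross = begin
      (+ (q ^ suc a) ℤ.- 1ℤ) ℤ.* + gauss a m
        ≡⟨ cong (ℤ._* + gauss a m) (q^n-1≡p*[n] (suc a)) ⟩
      + (p * [ suc a ]) ℤ.* + gauss a m
        ≡⟨ ℤₚ.pos-* (p * [ suc a ]) (gauss a m) ⟨
      + (p * [ suc a ] * gauss a m)
        ≡⟨ cong +_ (lemma p [ suc a ] (gauss a m)) ⟩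
      + (p * (gauss a m * [ suc a ]))
        ≡⟨ cong (λ x → + (p * x)) (gauss-upper-lower a m) ⟨
      + (p * (gauss (suc a) (suc m) * [ suc m ]))
        ≡⟨ cong +_ (lemma′ p [ suc m ] (gauss (suc a) (suc m))) ⟩
      + (gauss (suc a) (suc m) * (p * [ suc m ]))
        ≡⟨ cong (λ x → + (gauss (suc a) (suc m) * (x ∸ 1))) (p*[n]+1≡q^n (suc m)) ⟩
      + (gauss (suc a) (suc m) * (q ^ suc m ∸ 1))
        ≡⟨ ℤₚ.pos-* (gauss (suc a) (suc m)) _ ⟩
      + gauss (suc a) (suc m) ℤ.* + (q ^ suc m ∸ 1) ∎

  -- The eigenvalues as alternating sums

  -- T d e j (d ∸ i) h is the absolute value of the h-th summand of B_j(i).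
  T : (d e j a h : ℕ) → ℕ
  T d e j a h = q ^ (e * h + (j ∸ h) C 2) * gauss (d ∸ h) (d ∸ j) * gauss a h

  B≡altSum : .{{_ : NonTrivial q}} → ∀ d e j i → B q d e j i ≡ fromℤ (altSum (T d e j (d ∸ i)) j)
  B≡altSum d e j i = trans (Σℚ-cong {suc j} term≡) (Σℚ-altSum (T d e j (d ∸ i)) j)
    where
    open ≡-Reasoning
    term≡ : ∀ h → (-1ℤ ℤ.^ (j ∸ h) ℤ.* + (q ^ (e * h + (j ∸ h) C 2))) ℚ./ 1
                    ℚ.* gaussian q (d ∸ h) (d ∸ j) ℚ.* gaussian q (d ∸ i) h
                  ≡ fromℤ (-1ℤ ℤ.^ (j ∸ h) ℤ.* + T d e j (d ∸ i) h)
    term≡ h = begin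
      (s ℤ.* + x) ℚ./ 1 ℚ.* gaussian q (d ∸ h) (d ∸ j) ℚ.* gaussian q (d ∸ i) h
        ≡⟨ cong₂ (λ u v → u ℚ.* gaussian q (d ∸ h) (d ∸ j) ℚ.* v)
             (i/1≡fromℤ (s ℤ.* + x)) (gaussian≡gauss (d ∸ i) h) ⟩
      fromℤ (s ℤ.* + x) ℚ.* gaussian q (d ∸ h) (d ∸ j) ℚ.* fromℤ (+ z)
        ≡⟨ cong (λ u → fromℤ (s ℤ.* + x) ℚ.* u ℚ.* fromℤ (+ z)) (gaussian≡gauss (d ∸ h) (d ∸ j)) ⟩
      fromℤ (s ℤ.* + x) ℚ.* fromℤ (+ y) ℚ.* fromℤ (+ z)
        ≡⟨ cong (ℚ._* fromℤ (+ z)) (fromℤ-* (s ℤ.* + x) (+ y)) ⟩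
      fromℤ (s ℤ.* + x ℤ.* + y) ℚ.* fromℤ (+ z)
        ≡⟨ fromℤ-* (s ℤ.* + x ℤ.* + y) (+ z) ⟩
      fromℤ (s ℤ.* + x ℤ.* + y ℤ.* + z)
        ≡⟨ cong fromℤ (lemma s (+ x) (+ y) (+ z)) ⟩
      fromℤ (s ℤ.* (+ x ℤ.* + y ℤ.* + z))
        ≡⟨ cong (λ u → fromℤ (s ℤ.* (u ℤ.* + z))) (ℤₚ.pos-* x y) ⟨
      fromℤ (s ℤ.* (+ (x * y) ℤ.* + z))
        ≡⟨ cong (λ u → fromℤ (s ℤ.* u)) (ℤₚ.pos-* (x * y) z) ⟨
      fromℤ (s ℤ.* + (x * y * z)) ∎
      where
      s = -1ℤ ℤ.^ (j ∸ h)
      x = q ^ (e * h + (j ∸ h) C 2)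
      y = gauss (d ∸ h) (d ∸ j)
      z = gauss (d ∸ i) h
      lemma : ∀ s x y z → s ℤ.* x ℤ.* y ℤ.* z ≡ s ℤ.* (x ℤ.* y ℤ.* z)
      lemma = ℤ-Ring.solve-∀

  dominant : (d e j a : ℕ) → ℕ
  dominant d e j a = T d e j a (j ⊓ a)

  -- Doubling estimates for q ≥ 4

  module _ (3≤p : 3 ≤ p) where

    -- The form in which q ≥ 4 enters `[·]-bound`; at q = 3 it would read 6 ≤ 4.
    2*q≤p*p : 2 * q ≤ p * p
    2*q≤p*p = begin
      2 * q       ≡⟨ *-distribˡ-+ 2 1 p ⟩
      2 + 2 * p   ≤⟨ +-monoˡ-≤ (2 * p) (≤-trans (n≤1+n 2) 3≤p) ⟩
      3 * p       ≤⟨ *-monoˡ-≤ p 3≤p ⟩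
      p * p       ∎
      where open ≤-Reasoning

    2≤q : 2 ≤ q
    2≤q = s≤s (≤-trans (s≤s z≤n) 3≤p)

    gauss-doubles : ∀ a {m} → 1 ≤ m → 2 * gauss a m ≤ gauss (suc a) m
    gauss-doubles a {suc m} _ = begin
      2 * gauss a (suc m)                          ≤⟨ *-monoˡ-≤ (gauss a (suc m)) 2≤q^[1+m] ⟩
      q ^ suc m * gauss a (suc m)                  ≤⟨ m≤n+m _ (gauss a m) ⟩
      gauss a m + q ^ suc m * gauss a (suc m)      ∎
      where
      open ≤-Reasoning
      2≤q^[1+m] : 2 ≤ q ^ suc m
      2≤q^[1+m] = *-mono-≤ 2≤q (m^n>0 q m)

    -- What remains of a doubling step once common factors are cancelled. After multiplication by
    -- p², the bounds p[n] ≤ q^n and q^s ≤ [s + 1] reduce it to powers of q, and the surplus factor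
    -- 2q is at most p².
    [·]-bound : ∀ s r n l {e} → suc (n + l) ≤ e →
                2 * (q ^ s * ([ suc n ] * [ suc l ])) ≤ q ^ e * ([ suc s ] * [ suc r ])
    [·]-bound s r n l {e} n+l<e = *-cancelˡ-≤ (p * p) {{p*p≢0}} (begin
      p * p * (2 * (q ^ s * ([ suc n ] * [ suc l ])))
        ≡⟨ lemma₁ p (q ^ s) [ suc n ] [ suc l ] ⟩
      2 * (q ^ s * (p * [ suc n ] * (p * [ suc l ])))
        ≤⟨ *-monoʳ-≤ 2 (*-monoʳ-≤ (q ^ s) (*-mono-≤ (p*[n]≤q^n (suc n)) (p*[n]≤q^n (suc l)))) ⟩
      2 * (q ^ s * (q ^ suc n * q ^ suc l))
        ≡⟨ lemma₂ q (q ^ s) (q ^ n) (q ^ l) ⟩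
      2 * q * (q * (q ^ n * q ^ l) * q ^ s)
        ≡⟨ cong (λ x → 2 * q * (q * x * q ^ s)) (^-distribˡ-+-* q n l) ⟨
      2 * q * (q ^ suc (n + l) * q ^ s)
        ≤⟨ *-mono-≤ 2*q≤p*p (*-mono-≤ (^-monoʳ-≤ q n+l<e) (q^n≤[1+n] s)) ⟩
      p * p * (q ^ e * [ suc s ])
        ≡⟨ cong (λ x → p * p * (q ^ e * x)) (*-identityʳ [ suc s ]) ⟨
      p * p * (q ^ e * ([ suc s ] * 1))
        ≤⟨ *-monoʳ-≤ (p * p) (*-monoʳ-≤ (q ^ e) (*-monoʳ-≤ [ suc s ] (s≤s z≤n))) ⟩
      p * p * (q ^ e * ([ suc s ] * [ suc r ])) ∎)
      where
      open ≤-Reasoning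
      p*p≢0 : NonZero (p * p)
      p*p≢0 = >-nonZero (≤-trans (s≤s z≤n) 2*q≤p*p)
      lemma₁ : ∀ p x y z → p * p * (2 * (x * (y * z))) ≡ 2 * (x * (p * y * (p * z)))
      lemma₁ = solve-∀
      lemma₂ : ∀ q x y z → 2 * (x * (q * y * (q * z))) ≡ 2 * q * (q * (y * z) * x)
      lemma₂ = solve-∀

    -- Covers both the step from h to h + 1 at fixed i, where H and H′ are consecutive
    -- Gaussian coefficients, and the step from i + 1 to i of a dominant term with
    -- d − i ≤ j, where h = d − i − 1 and H = H′ = 1.
    double-step : ∀ {d e j h l r H H′} → h < j → j ≤ d → suc (d ∸ suc h + l) ≤ e →
      H′ * [ suc l ] ≡ H * [ suc r ] →
      2 * (q ^ (e * h + (j ∸ h) C 2) * gauss (d ∸ h) (d ∸ j) * H)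
        ≤ q ^ (e * suc h + (j ∸ suc h) C 2) * gauss (d ∸ suc h) (d ∸ j) * H′
    double-step {d} {e} {j} {h} {l} {r} {H} {H′} h<j j≤d n+l<e H-eq =
      -- The ratios are G′/G = [s + 1]/[n + 1] and H′/H = [r + 1]/[l + 1]; multiplying by both
      -- denominators keeps the computation in ℕ.
      *-cancelʳ-≤ _ _ ([ suc n ] * [ suc l ]) (begin
        2 * (q ^ (e * h + (j ∸ h) C 2) * gauss (d ∸ h) m * H) * ([ suc n ] * [ suc l ])
          ≡⟨ cong₂ (λ x y → 2 * (x * gauss y m * H) * ([ suc n ] * [ suc l ]))
               q^-eq (∸-suc-≡ (<-≤-trans h<j j≤d)) ⟩
        2 * (X * q ^ s * G * H) * ([ suc n ] * [ suc l ])
          ≡⟨ lemma₁ X (q ^ s) G H [ suc n ] [ suc l ] ⟩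
        X * G * H * (2 * (q ^ s * ([ suc n ] * [ suc l ])))
          ≤⟨ *-monoʳ-≤ (X * G * H) ([·]-bound s r n l n+l<e) ⟩
        X * G * H * (q ^ e * ([ suc s ] * [ suc r ]))
          ≡⟨ lemma₂ X G H (q ^ e) [ suc s ] [ suc r ] ⟩
        X * q ^ e * (G * [ suc s ]) * (H * [ suc r ])
          ≡⟨ cong₂ (λ x y → X * q ^ e * x * y) G-eq (sym H-eq) ⟩
        X * q ^ e * (G′ * [ suc n ]) * (H′ * [ suc l ])
          ≡⟨ lemma₃ (X * q ^ e) G′ H′ [ suc n ] [ suc l ] ⟩
        X * q ^ e * G′ * H′ * ([ suc n ] * [ suc l ])
          ≡⟨ cong (λ x → x * G′ * H′ * ([ suc n ] * [ suc l ])) q^-eq′ ⟨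
        q ^ (e * suc h + s C 2) * G′ * H′ * ([ suc n ] * [ suc l ]) ∎)
      where
      open ≤-Reasoning
      n = d ∸ suc h
      m = d ∸ j
      s = j ∸ suc h
      X = q ^ (e * h + s C 2)
      G = gauss (suc n) m
      G′ = gauss n m
      d-h≡1+n : d ∸ h ≡ suc n
      d-h≡1+n = ∸-suc-≡ (<-≤-trans h<j j≤d)
      q^-eq : q ^ (e * h + (j ∸ h) C 2) ≡ X * q ^ s
      q^-eq = trans
        (cong (q ^_) (trans
          (cong (λ x → e * h + x) (trans (cong (_C 2) (∸-suc-≡ h<j)) (trans ([1+n]C2≡n+nC2 s) (+-comm s _))))
          (sym (+-assoc (e * h) _ s))))
        (^-distribˡ-+-* q (e * h + s C 2) s)
      q^-eq′ : q ^ (e * suc h + s C 2) ≡ X * q ^ e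
      q^-eq′ = trans (cong (q ^_) (lemma e h (s C 2))) (^-distribˡ-+-* q (e * h + s C 2) e)
        where
        lemma : ∀ e h c → e * (1 + h) + c ≡ e * h + c + e
        lemma = solve-∀
      1+n-m≡1+s : suc n ∸ m ≡ suc s
      1+n-m≡1+s = begin-equality
        suc n ∸ m          ≡⟨ cong (_∸ m) (sym d-h≡1+n) ⟩
        d ∸ h ∸ (d ∸ j)    ≡⟨ ∸-+-assoc d h (d ∸ j) ⟩
        d ∸ (h + (d ∸ j))  ≡⟨ cong (d ∸_) (+-comm h (d ∸ j)) ⟩
        d ∸ (d ∸ j + h)    ≡⟨ ∸-+-assoc d (d ∸ j) h ⟨
        d ∸ (d ∸ j) ∸ h    ≡⟨ cong (_∸ h) (m∸[m∸n]≡n j≤d) ⟩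
        j ∸ h              ≡⟨ ∸-suc-≡ h<j ⟩
        suc s              ∎
      G-eq : G * [ suc s ] ≡ G′ * [ suc n ]
      G-eq = trans (cong (λ x → G * [ x ]) (sym 1+n-m≡1+s)) (gauss-upper n m)
      lemma₁ : ∀ X x G H y z → 2 * (X * x * G * H) * (y * z) ≡ X * G * H * (2 * (x * (y * z)))
      lemma₁ = solve-∀
      lemma₂ : ∀ X G H x y z → X * G * H * (x * (y * z)) ≡ X * x * (G * y) * (H * z)
      lemma₂ = solve-∀
      lemma₃ : ∀ X G H y z → X * (G * y) * (H * z) ≡ X * G * H * (y * z)
      lemma₃ = solve-∀

    module _ {d e j : ℕ} (d≤e : d ≤ e) (j≤d : j ≤ d) where

      -- Here l = h in `double-step`, so its exponent condition n + l + 1 ≤ e is exactly d ≤ e.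
      T-doubles-in-h : ∀ a h → h < j → h < a → 2 * T d e j a h ≤ T d e j a (suc h)
      T-doubles-in-h a h h<j h<a = double-step {r = a ∸ suc h} h<j j≤d n+h<e
        (trans (gauss-lower a h) (cong (λ x → gauss a h * [ x ]) (∸-suc-≡ h<a)))
        where
        n+h<e : suc (d ∸ suc h + h) ≤ e
        n+h<e = subst (_≤ e)
          (trans (sym (m∸n+n≡m (<-≤-trans h<j j≤d))) (+-suc (d ∸ suc h) h)) d≤e

      ∣altSum-T∣-bounds : ∀ a → let x = ℤ.∣ altSum (T d e j a) j ∣ in
                          x ≤ dominant d e j a × dominant d e j a ≤ 2 * x
      ∣altSum-T∣-bounds a =
        let x , eq , x≤t , t≤2x = altSum-bounds (T d e j a) k doubles
            ∣eq∣ = sym (trans truncate (cong ℤ.∣_∣ eq))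
        in subst (λ y → y ≤ T d e j a k × T d e j a k ≤ 2 * y) ∣eq∣ (x≤t , t≤2x)
        where
        k = j ⊓ a
        doubles : ∀ h → h < k → 2 * T d e j a h ≤ T d e j a (suc h)
        doubles h h<k =
          T-doubles-in-h a h (<-≤-trans h<k (m⊓n≤m j a)) (<-≤-trans h<k (m⊓n≤n j a))
        j-k+k≡j : j ∸ k + k ≡ j
        j-k+k≡j = m∸n+n≡m (m⊓n≤m j a)
        -- As h ≤ j, being above min(j, a) forces h > a, where the last Gaussian coefficient is 0.
        vanish : ∀ h → k < h → h ≤ j ∸ k + k → T d e j a h ≡ 0
        vanish h k<h h≤j with ≤-<-connex h a
        ... | inj₁ h≤a = contradiction (⊓-glb (subst (h ≤_) j-k+k≡j h≤j) h≤a) (<⇒≱ k<h)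
        ... | inj₂ a<h = trans (cong (c *_) (gauss-vanishes a<h)) (*-zeroʳ c)
          where c = q ^ (e * h + (j ∸ h) C 2) * gauss (d ∸ h) (d ∸ j)
        truncate : ℤ.∣ altSum (T d e j a) j ∣ ≡ ℤ.∣ altSum (T d e j a) k ∣
        truncate = trans (cong (λ l → ℤ.∣ altSum (T d e j a) l ∣) (sym j-k+k≡j))
          (∣altSum∣-vanishing (T d e j a) k (j ∸ k) vanish)

      -- If j ≤ a, the dominant index stays at j and only `gauss a j` grows; this uses j ≥ 1, as
      -- `gauss a 0` is constant. If a < j, the index moves from a to a + 1 and the last Gaussian
      -- coefficient is 1 at both ends.
      dominant-doubles : ∀ a → suc a ≤ d → 1 ≤ j → 2 * dominant d e j a ≤ dominant d e j (suc a)
      dominant-doubles a a<d 1≤j with ≤-<-connex j a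
      ... | inj₁ j≤a rewrite m≤n⇒m⊓n≡m j≤a | m≤n⇒m⊓n≡m (m≤n⇒m≤1+n j≤a) = begin
        2 * (c * gauss a j)    ≡⟨ lemma c (gauss a j) ⟩
        c * (2 * gauss a j)    ≤⟨ *-monoʳ-≤ c (gauss-doubles a 1≤j) ⟩
        c * gauss (suc a) j    ∎
        where
        open ≤-Reasoning
        c = q ^ (e * j + (j ∸ j) C 2) * gauss (d ∸ j) (d ∸ j)
        lemma : ∀ c y → 2 * (c * y) ≡ c * (2 * y)
        lemma = solve-∀
      ... | inj₂ a<j rewrite m≥n⇒m⊓n≡n (<⇒≤ a<j) | m≥n⇒m⊓n≡n a<j = double-step {l = 0} {r = 0} a<j j≤d
        -- With l = 0 the exponent condition becomes d - a ≤ e.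
        (subst (_≤ e) (trans (∸-suc-≡ a<d) (cong suc (sym (+-identityʳ (d ∸ suc a)))))
          (≤-trans (m∸n≤m d a) d≤e))
        (cong (_* [ 1 ]) (trans (gauss-diag (suc a)) (sym (gauss-diag a))))

      dominant-gap : ∀ {a b} → 1 ≤ j → a < b → b ≤ d → 2 * dominant d e j a ≤ dominant d e j b
      dominant-gap {a} {suc b} 1≤j (s≤s a≤b) b<d with m≤n⇒m<n∨m≡n a≤b
      ... | inj₂ refl = dominant-doubles a b<d 1≤j
      ... | inj₁ a<b  = ≤-trans (dominant-gap 1≤j a<b (<⇒≤ b<d))
        (≤-trans (m≤n*m _ 2) (dominant-doubles b b<d 1≤j))

      -- The factor 2 gained between the dominant terms pays for the factor 2 lost in bounding the
      -- sum at b from below by its dominant term.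
      ∣altSum-T∣-≤ : ∀ {a b} → 1 ≤ j → a < b → b ≤ d →
                     ℤ.∣ altSum (T d e j a) j ∣ ≤ ℤ.∣ altSum (T d e j b) j ∣
      ∣altSum-T∣-≤ {a} {b} 1≤j a<b b≤d =
        let x≤t , _ = ∣altSum-T∣-bounds a
            _ , u≤2y = ∣altSum-T∣-bounds b
        in *-cancelˡ-≤ 2 (≤-trans (*-monoʳ-≤ 2 x≤t) (≤-trans (dominant-gap 1≤j a<b b≤d) u≤2y))

-- From the estimates in ℕ back to the rational eigenvalues

theorem7p5 : (q d e : ℕ) → PrimePower q → (q≥4 : 4 ≤ q) → 1 ≤ d → d ≤ e →
    (i j : ℕ) → 1 ≤ i → i ≤ d → j ≤ d →
    let instance q-nonTrivial = 4≤⇒nonTrivial q≥4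
    in ∣ B q d e j 1 ∣ ≥ ∣ B q d e j i ∣
-- For j = 0 the only summand has h = 0 and does not depend on i, so both sides agree by
-- computation.
theorem7p5 _ d e _ (s≤s _) 1≤d d≤e _ zero 1≤i i≤d j≤d = ℚₚ.≤-refl
theorem7p5 _ d e _ (s≤s _) 1≤d d≤e 1 (suc j) 1≤i i≤d j≤d = ℚₚ.≤-refl
theorem7p5 (suc p) d e _ q≥4@(s≤s 3≤p) 1≤d d≤e i@(suc (suc _)) j@(suc _) 1≤i i≤d j≤d =
  subst₂ ℚ._≤_ (∣B∣≡ i) (∣B∣≡ 1)
    -- Since i ≥ 2, the comparison applies with a = d - i < d - 1 = b.
    (fromℤ-mono-≤ (+≤+ (∣altSum-T∣-≤ p 3≤p d≤e j≤d (s≤s z≤n) (∸-monoʳ-< (s≤s (s≤s z≤n)) i≤d) (m∸n≤m d 1))))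
  where
  instance q-nonTrivial = 4≤⇒nonTrivial q≥4
  ∣B∣≡ : ∀ i → fromℤ (+ ℤ.∣ altSum (T p d e j (d ∸ i)) j ∣) ≡ ∣ B (suc p) d e j i ∣
  ∣B∣≡ i = trans (sym (∣fromℤ∣ (altSum (T p d e j (d ∸ i)) j))) (cong ∣_∣ (sym (B≡altSum p d e j i)))
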